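{- Let $(R_1,\mathcal L_1)$ and $(R_2,\mathcal L_2)$ be recursive rings with a recursive interpretation of a language. If MRDP holds in $(R_2,\mathcal L_2)$, then every r.e. preserving map $f:R_1\to R_2$ is also a Diophantine map.
   Context: A recursive ring is a ring $R$ with a fixed recursive representation, i.e. an injection $j:R\to\mathbb N$ with recursive image for which addition and multiplication are recursive; subsets of $R^k$ are recursive / recursively enumerable if their images under $j^k$ are. A language $\mathcal L$ (constants, functions, relations; always containing a constant $0$ and equality) has a recursive interpretation in $R$ if all its functions are interpreted by recursive functions and all its relations by recursive sets. Terms are built from constants and variables using functions of $\mathcal L$; basic formulas are $(t_1,\ldots,t_k)\in R'$ with $R'\in\mathcal L$ a $k$-ary relation (possibly equality). $S\subset R^k$ is Diophantine if $S=\{\vec x\in R^k\mid\exists\vec y\in R^l\ (f_1\wedge\cdots\wedge f_r)\}$ for some basic formulas $f_i$. $d:R_1\to R_2$ is a Diophantine map if the coordinatewise image $d(S)\subset R_2^k$ is Diophantine for all $k$ and all Diophantine $S\subset R_1^k$. MRDP holds in $(R,\mathcal L)$ if every recursively enumerable $S\subset R$ is Diophantine in $(R,\mathcal L)$. $f:R_1\to R_2$ is r.e. preserving if $f(S)\subset R_2$ is recursively enumerable for all recursively enumerable $S\subset R_1$.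
   Formalization: MRDP in R_2 and "r.e. preserving" are required for r.e. subsets of all finite powers R^k (coordinatewise images), not only for S ⊂ R; with subsets of R alone the claim is false (e.g. f on Z with f(2n)=n, f(2n+1)=χ_A(n), A non-recursive). -}

module Defs where

open import Level using (0ℓ)
open import Algebra.Bundles using (Ring)
open import Data.Nat.Base using (ℕ; zero; suc; _+_; _<_)
open import Data.Fin.Base using (Fin)
open import Data.List.Base using (List)
open import Data.List.Relation.Unary.All using (All)
open import Data.Product.Base using (∃; ∃-syntax; _×_; _,_)
open import Data.Sum.Base using (_⊎_)
open import Data.Vec.Base using (Vec; []; _∷_; [_]; _++_; map; lookup)
open import Data.Vec.Relation.Binary.Pointwise.Inductive using (Pointwise)
import Data.Vec.Relation.Binary.Equality.Setoid as VecEq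
open import Function.Bundles using (Func; Injection; _⇔_)
open import Relation.Binary.PropositionalEquality using (_≡_; setoid)
open import Relation.Nullary.Negation using (¬_)
open import Relation.Binary.Definitions using (_Respects_)
open import Relation.Unary using (Pred)

-- Kleene's μ-recursive partial functions ℕⁿ ⇀ ℕ.

data Code : ℕ → Set where
  zero : ∀ {n} → Code n
  suc  : Code 1
  proj : ∀ {n} → Fin n → Code n
  comp : ∀ {m n} → Code m → Vec (Code n) m → Code n
  prec : ∀ {n} → Code n → Code (suc (suc n)) → Code (suc n)
  μ    : ∀ {n} → Code (suc n) → Code n

infix 4 _∙_⇓_

-- e ∙ xs ⇓ y : the partial function coded by e is defined at xs, with value y.
-- The step function of prec takes the counter, the previous value, and the
-- parameters, in this order.
data _∙_⇓_ : ∀ {n} → Code n → Vec ℕ n → ℕ → Set where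
  ⇓zero  : ∀ {n} {xs : Vec ℕ n} → zero ∙ xs ⇓ 0
  ⇓suc   : ∀ {x} → suc ∙ [ x ] ⇓ suc x
  ⇓proj  : ∀ {n} {xs : Vec ℕ n} (i : Fin n) → proj i ∙ xs ⇓ lookup xs i
  ⇓comp  : ∀ {m n} {g : Code m} {hs : Vec (Code n) m} {xs ys z} →
           Pointwise (λ h y → h ∙ xs ⇓ y) hs ys → g ∙ ys ⇓ z →
           comp g hs ∙ xs ⇓ z
  ⇓prec₀ : ∀ {n} {g : Code n} {h xs y} →
           g ∙ xs ⇓ y → prec g h ∙ 0 ∷ xs ⇓ y
  ⇓precₛ : ∀ {n} {g : Code n} {h xs i y z} →
           prec g h ∙ i ∷ xs ⇓ y → h ∙ i ∷ y ∷ xs ⇓ z →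
           prec g h ∙ suc i ∷ xs ⇓ z
  ⇓μ     : ∀ {n} {f : Code (suc n)} {xs m} →
           (∀ i → i < m → ∃[ y ] f ∙ i ∷ xs ⇓ suc y) →
           f ∙ m ∷ xs ⇓ 0 → μ f ∙ xs ⇓ m

IsRecursive : ∀ {n} → (Vec ℕ n → ℕ) → Set
IsRecursive F = ∃[ e ] (∀ xs → e ∙ xs ⇓ F xs)

IsRecursiveSet : ∀ {n} → Pred (Vec ℕ n) 0ℓ → Set
IsRecursiveSet P = ∃[ χ ] IsRecursive χ ×
  (∀ xs → (P xs × χ xs ≡ 1) ⊎ (¬ P xs × χ xs ≡ 0))

-- Recursively enumerable sets as domains of partial recursive functions.
IsRESet : ∀ {n} → Pred (Vec ℕ n) 0ℓ → Set
IsRESet P = ∃[ e ] (∀ xs → P xs ⇔ (∃[ y ] e ∙ xs ⇓ y))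

-- The same notions transported along a map j : A → ℕ.
module _ {A : Set} (j : A → ℕ) where

  codeImage : ∀ {k} → Pred (Vec A k) 0ℓ → Pred (Vec ℕ k) 0ℓ
  codeImage S ns = ∃[ xs ] S xs × map j xs ≡ ns

  -- A function Aᵏ → A is recursive when some total recursive function ℕᵏ → ℕ
  -- represents it on codes.  As the set of codes will be recursive, this is the
  -- same as recursiveness of the function on j(A)ᵏ, since any such function
  -- extends by 0.
  IsRecursiveOp : ∀ {k} → (Vec A k → A) → Set
  IsRecursiveOp f = ∃[ F ] IsRecursive F × (∀ xs → F (map j xs) ≡ j (f xs))

record RecursiveRing : Set₁ where
  field
    ring : Ring 0ℓ 0ℓ

  open Ring ring public
    using (Carrier; _≈_; 0#)
    renaming (_+_ to _+ᴿ_; _*_ to _*ᴿ_; setoid to ≈-setoid)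

  field
    rep : Injection ≈-setoid (setoid ℕ)

  j : Carrier → ℕ
  j = Injection.to rep

  field
    image-recursive : IsRecursiveSet {1} (λ ns → ∃[ x ] [ j x ] ≡ ns)
    +-recursive     : IsRecursiveOp j {2} (λ { (x ∷ y ∷ []) → x +ᴿ y })
    *-recursive     : IsRecursiveOp j {2} (λ { (x ∷ y ∷ []) → x *ᴿ y })

  open VecEq ≈-setoid public using (_≋_)

-- Equality in a ring is a setoid equality, so subsets must be closed under it.
record Subset (R : RecursiveRing) (k : ℕ) : Set₁ where
  open RecursiveRing R
  field
    holds : Pred (Vec Carrier k) 0ℓ
    resp  : holds Respects _≋_

open Subset public

IsRE : ∀ {R k} → Subset R k → Set
IsRE {R} S = IsRESet (codeImage (RecursiveRing.j R) (holds S))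

record Language : Set₁ where
  field
    Const  : Set
    Fun    : ℕ → Set
    Rel    : ℕ → Set
    zeroᶜ  : Const
    equalʳ : Rel 2

record Interpretation (L : Language) (R : RecursiveRing) : Set₁ where
  open Language L
  open RecursiveRing R
  field
    ⟦_⟧ᶜ   : Const → Carrier
    ⟦_⟧ᶠ   : ∀ {n} → Fun n → Vec Carrier n → Carrier
    ⟦⟧ᶠ-cong : ∀ {n} (F : Fun n) {xs ys} → xs ≋ ys → ⟦ F ⟧ᶠ xs ≈ ⟦ F ⟧ᶠ ys
    ⟦_⟧ʳ   : ∀ {n} → Rel n → Subset R n
    zeroᶜ-interp  : ⟦ zeroᶜ ⟧ᶜ ≈ 0#
    equalʳ-interp : ∀ x y → holds ⟦ equalʳ ⟧ʳ (x ∷ y ∷ []) ⇔ x ≈ y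

  IsRecursiveInterpretation : Set
  IsRecursiveInterpretation =
    (∀ {n} (F : Fun n) → IsRecursiveOp j ⟦ F ⟧ᶠ) ×
    (∀ {n} (P : Rel n) → IsRecursiveSet (codeImage j (holds ⟦ P ⟧ʳ)))

module Syntax (L : Language) where
  open Language L

  data Term (v : ℕ) : Set where
    var   : Fin v → Term v
    const : Const → Term v
    app   : ∀ {n} → Fun n → Vec (Term v) n → Term v

  data BasicFormula (v : ℕ) : Set where
    rel : ∀ {n} → Rel n → Vec (Term v) n → BasicFormula v

module _ {L : Language} {R : RecursiveRing} (I : Interpretation L R) where
  open Syntax L
  open RecursiveRing R
  open Interpretation I

  eval  : ∀ {v} → Vec Carrier v → Term v → Carrier
  evals : ∀ {v n} → Vec Carrier v → Vec (Term v) n → Vec Carrier n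
  eval ρ (var i)    = lookup ρ i
  eval ρ (const c)  = ⟦ c ⟧ᶜ
  eval ρ (app F ts) = ⟦ F ⟧ᶠ (evals ρ ts)
  evals ρ []        = []
  evals ρ (t ∷ ts)  = eval ρ t ∷ evals ρ ts

  Sat : ∀ {v} → Vec Carrier v → BasicFormula v → Set
  Sat ρ (rel P ts) = holds ⟦ P ⟧ʳ (evals ρ ts)

  IsDiophantine : ∀ {k} → Subset R k → Set
  IsDiophantine {k} S =
    ∃[ l ] ∃[ fs ] (∀ xs → holds S xs ⇔
      (∃[ ys ] All (Sat {k + l} (xs ++ ys)) fs))

  -- MRDP is about r.e. subsets of all finite powers of the ring: a language need
  -- not provide Diophantine coding of tuples, so powers cannot be reduced to R.
  MRDP : Set₁
  MRDP = ∀ k (S : Subset R k) → IsRE S → IsDiophantine S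

module _ {R₁ R₂ : RecursiveRing} where
  private
    module R₁ = RecursiveRing R₁
    module R₂ = RecursiveRing R₂

  image : Func R₁.≈-setoid R₂.≈-setoid → ∀ {k} → Subset R₁ k → Subset R₂ k
  image f S = record
    { holds = λ ys → ∃[ xs ] holds S xs × map (Func.to f) xs R₂.≋ ys
    ; resp  = λ ys≋zs (xs , xs∈S , fxs≋ys) →
        xs , xs∈S , VecEq.≋-trans R₂.≈-setoid fxs≋ys ys≋zs
    }

  IsDiophantineMap : ∀ {L₁ L₂} → Interpretation L₁ R₁ → Interpretation L₂ R₂ →
                     Func R₁.≈-setoid R₂.≈-setoid → Set₁
  IsDiophantineMap I₁ I₂ f = ∀ k (S : Subset R₁ k) →
    IsDiophantine I₁ S → IsDiophantine I₂ (image f S)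

  -- As for Diophantine maps, images are taken coordinatewise in all finite powers.
  -- Subsets of R₁ alone would not do: a map sending 2n to n and 2n+1 to χ_A(n),
  -- for any A ⊆ ℤ, sends r.e. subsets of ℤ to r.e. subsets, but it sends
  -- {(2n , 2n+1)} to the graph of χ_A.
  IsREPreserving : Func R₁.≈-setoid R₂.≈-setoid → Set₁
  IsREPreserving f = ∀ k (S : Subset R₁ k) → IsRE S → IsRE (image f S)

{-# OPTIONS --safe #-}
module Submission where

-- The statement reduces to one fact: in a recursive ring with a recursive
-- interpretation of a language, every Diophantine set is recursively enumerable
-- (diophantine⇒re).  Given a Diophantine S in R₁, S is then r.e., its image is
-- r.e. because f preserves r.e. sets, and MRDP in R₂ makes the image Diophantine.
--
-- To see that a Diophantine set is r.e., work on codes.  A term is represented by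
-- a recursive function on the codes of its variables, so a system of basic
-- formulas in v variables holds exactly at the zeros of some total recursive
-- function on the codes (sats-zeroSet); the tuples of codes of ring elements are
-- the zeros of another (codes-zeroSet).  Hence the codes of solutions form a
-- "zero set" in ℕᵛ.
--
-- The existential variables are then removed one at a time within the class of
-- sets of the form {x | ∃ b. H(b, x) = 0} with H total recursive.  No pairing
-- function is needed: ∃ y. ∃ c. H(c, y, x) = 0 holds iff
-- ∏_{y<b} ∏_{c<b} H(c, y, x) = 0 for some b, and bounded products of recursive
-- functions are recursive (semirecursive-∃).  Finally a set of this form is the
-- domain of the partial function μb. H(b, x) (semirecursive⇒re).

open import Defs
open import Level using (0ℓ)
open import Data.Nat.Base using (ℕ; zero; suc; _+_; _*_; _<_; _⊔_; s≤s)
open import Data.Nat.Properties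
  using (m<1+n⇒m<n∨m≡n; m+n≡0⇒m≡0; m+n≡0⇒n≡0; m*n≡0⇒m≡0∨n≡0; *-zeroʳ;
         <-cmp; m≤m⊔n; m≤n⊔m)
open import Data.Fin.Base using (Fin; zero; suc; _↑ˡ_; _↑ʳ_; splitAt)
open import Data.List.Base using (List; []; _∷_)
open import Data.List.Relation.Unary.All using (All; []; _∷_)
open import Data.Product.Base using (∃; ∃-syntax; _×_; _,_; proj₁; proj₂)
open import Data.Sum.Base using (inj₁; inj₂; [_,_]′)
open import Data.Unit.Base using (⊤; tt)
open import Data.Vec.Base as Vec
  using (Vec; []; _∷_; [_]; _++_; head; tail; take; drop; map; lookup; tabulate)
open import Data.Vec.Properties
  using (map-++; ++-injectiveˡ; lookup-++ˡ; lookup-++ʳ; lookup-splitAt;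
         lookup-map; tabulate∘lookup; ∷-injectiveˡ; ∷-injectiveʳ)
open import Data.Vec.Relation.Binary.Pointwise.Inductive
  using (Pointwise; []; _∷_; tabulate⁺)
open import Function.Base using (_∘_)
open import Function.Bundles using (Func; Injection; Equivalence; _⇔_; mk⇔)
open import Relation.Binary.Definitions using (tri<; tri≈; tri>)
open import Relation.Binary.PropositionalEquality
  using (_≡_; _≗_; refl; sym; trans; cong; cong₂; subst)
open import Relation.Nullary.Negation using (contradiction)
open import Relation.Unary using (Pred)

open Equivalence using (to; from)

private
  variable
    m n : ℕ

-- Closure properties of total recursive functions

-- Functions ℕⁿ → ℕᵐ all of whose components are recursive, given by a vector of
-- codes so that they can be fed to comp directly.
IsRecursiveMap : (Vec ℕ n → Vec ℕ m) → Set
IsRecursiveMap {n} {m} F =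
  ∃ λ (es : Vec (Code n) m) → ∀ xs → Pointwise (λ e y → e ∙ xs ⇓ y) es (F xs)

rec-ext : {F G : Vec ℕ n → ℕ} → F ≗ G → IsRecursive F → IsRecursive G
rec-ext F≗G (e , e⇓) = e , λ xs → subst (e ∙ xs ⇓_) (F≗G xs) (e⇓ xs)

rec-∘ : {G : Vec ℕ m → ℕ} {F : Vec ℕ n → Vec ℕ m} →
        IsRecursive G → IsRecursiveMap F → IsRecursive (G ∘ F)
rec-∘ {F = F} (g , g⇓) (es , es⇓) = comp g es , λ xs → ⇓comp (es⇓ xs) (g⇓ (F xs))

recMap-[] : IsRecursiveMap {n} (λ _ → [])
recMap-[] = [] , λ _ → []

recMap-∷ : {F : Vec ℕ n → ℕ} {G : Vec ℕ n → Vec ℕ m} →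
           IsRecursive F → IsRecursiveMap G → IsRecursiveMap (λ xs → F xs ∷ G xs)
recMap-∷ (e , e⇓) (es , es⇓) = e ∷ es , λ xs → e⇓ xs ∷ es⇓ xs

-- Rearranging coordinates is recursive.
recMap-select : {F : Vec ℕ n → Vec ℕ m} (σ : Fin m → Fin n) →
                (∀ xs i → lookup xs (σ i) ≡ lookup (F xs) i) → IsRecursiveMap F
recMap-select {F = F} σ eq = tabulate (λ i → proj (σ i)) , λ xs →
  subst (Pointwise (λ e y → e ∙ xs ⇓ y) _) (tabulate∘lookup (F xs))
    (tabulate⁺ λ i → subst (proj (σ i) ∙ xs ⇓_) (eq xs i) (⇓proj (σ i)))

rec-lookup : (i : Fin n) → IsRecursive (λ xs → lookup xs i)
rec-lookup i = proj i , λ _ → ⇓proj i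

rec-suc : {F : Vec ℕ n → ℕ} → IsRecursive F → IsRecursive (λ xs → suc (F xs))
rec-suc (e , e⇓) = comp suc (e ∷ []) , λ xs → ⇓comp (e⇓ xs ∷ []) ⇓suc

rec-const : ∀ c → IsRecursive {n} (λ _ → c)
rec-const zero    = zero , λ _ → ⇓zero
rec-const (suc c) = rec-suc (rec-const c)

-- Primitive recursion on i from base G and step H, which takes the counter, the
-- previous value and the parameters, as for prec.
primRec : (Vec ℕ n → ℕ) → (Vec ℕ (suc (suc n)) → ℕ) → ℕ → Vec ℕ n → ℕ
primRec G H zero    xs = G xs
primRec G H (suc i) xs = H (i ∷ primRec G H i xs ∷ xs)

rec-primRec : {G : Vec ℕ n → ℕ} {H : Vec ℕ (suc (suc n)) → ℕ}
              {B : Vec ℕ m → ℕ} {F : Vec ℕ m → Vec ℕ n} →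
              IsRecursive G → IsRecursive H → IsRecursive B → IsRecursiveMap F →
              IsRecursive (λ xs → primRec G H (B xs) (F xs))
rec-primRec {G = G} {H} {B} {F} (g , g⇓) (h , h⇓) (b , b⇓) (es , es⇓) =
  comp (prec g h) (b ∷ es) , λ xs → ⇓comp (b⇓ xs ∷ es⇓ xs) (iterate⇓ (B xs) (F xs))
  where
  iterate⇓ : ∀ i xs → prec g h ∙ i ∷ xs ⇓ primRec G H i xs
  iterate⇓ zero    xs = ⇓prec₀ (g⇓ xs)
  iterate⇓ (suc i) xs = ⇓precₛ (iterate⇓ i xs) (h⇓ _)

rec-+ : {F G : Vec ℕ n → ℕ} →
        IsRecursive F → IsRecursive G → IsRecursive (λ xs → F xs + G xs)
rec-+ {F = F} {G} F-rec G-rec =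
  rec-ext (λ xs → primRec≡+ (F xs) (G xs))
    (rec-primRec base-rec step-rec F-rec (recMap-∷ G-rec recMap-[]))
  where
  base-rec = rec-lookup {1} zero
  step-rec = rec-suc (rec-lookup {3} (suc zero))

  primRec≡+ : ∀ x y → primRec (λ ys → lookup ys zero)
                              (λ ys → suc (lookup ys (suc zero))) x (y ∷ []) ≡ x + y
  primRec≡+ zero    y = refl
  primRec≡+ (suc x) y = cong suc (primRec≡+ x y)

rec-* : {F G : Vec ℕ n → ℕ} →
        IsRecursive F → IsRecursive G → IsRecursive (λ xs → F xs * G xs)
rec-* {F = F} {G} F-rec G-rec =
  rec-ext (λ xs → primRec≡* (F xs) (G xs))
    (rec-primRec base-rec step-rec F-rec (recMap-∷ G-rec recMap-[]))
  where
  base-rec = rec-const {1} 0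
  step-rec = rec-+ (rec-lookup {3} (suc (suc zero))) (rec-lookup (suc zero))

  primRec≡* : ∀ x y → primRec (λ _ → 0)
                              (λ ys → lookup ys (suc (suc zero)) + lookup ys (suc zero))
                              x (y ∷ []) ≡ x * y
  primRec≡* zero    y = refl
  primRec≡* (suc x) y = cong (y +_) (primRec≡* x y)

-- The characteristic function of {0}.
isZero : ℕ → ℕ
isZero zero    = 1
isZero (suc _) = 0

rec-isZero : {F : Vec ℕ n → ℕ} → IsRecursive F → IsRecursive (λ xs → isZero (F xs))
rec-isZero {F = F} F-rec =
  rec-ext (λ xs → primRec≡isZero (F xs))
    (rec-primRec (rec-const {0} 1) (rec-const 0) F-rec recMap-[])
  where
  primRec≡isZero : ∀ x → primRec (λ _ → 1) (λ _ → 0) x [] ≡ isZero x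
  primRec≡isZero zero    = refl
  primRec≡isZero (suc x) = refl

-- Bounded products express bounded existential quantification over zeros.

-- ∏< b h = h 0 * ⋯ * h (b - 1)
∏< : ℕ → (ℕ → ℕ) → ℕ
∏< zero    h = 1
∏< (suc b) h = ∏< b h * h b

∏<≡0⇒ : ∀ b {h} → ∏< b h ≡ 0 → ∃[ y ] h y ≡ 0
∏<≡0⇒ (suc b) {h} eq with m*n≡0⇒m≡0∨n≡0 (∏< b h) eq
... | inj₁ eq′ = ∏<≡0⇒ b eq′
... | inj₂ eq′ = b , eq′

⇒∏<≡0 : ∀ {b y h} → y < b → h y ≡ 0 → ∏< b h ≡ 0
⇒∏<≡0 {suc b} {y} {h} y<1+b eq with m<1+n⇒m<n∨m≡n y<1+b
... | inj₁ y<b  = cong (_* h b) (⇒∏<≡0 y<b eq)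
... | inj₂ refl = trans (cong (∏< b h *_) eq) (*-zeroʳ (∏< b h))

rec-∏< : {B : Vec ℕ n → ℕ} {H : Vec ℕ (suc n) → ℕ} →
         IsRecursive B → IsRecursive H →
         IsRecursive (λ xs → ∏< (B xs) (λ y → H (y ∷ xs)))
rec-∏< {n} {B} {H} B-rec H-rec =
  rec-ext (λ xs → primRec≡∏< (B xs) xs)
    (rec-primRec (rec-const 1) step-rec B-rec (recMap-select (λ i → i) λ _ _ → refl))
  where
  -- Drops the previous value from the arguments (counter, value, parameters).
  forget : Vec ℕ (suc (suc n)) → Vec ℕ (suc n)
  forget ys = head ys ∷ tail (tail ys)

  forget-rec : IsRecursiveMap forget
  forget-rec = recMap-select (λ { zero → zero ; (suc i) → suc (suc i) })
    λ { (_ ∷ _ ∷ _) zero → refl ; (_ ∷ _ ∷ _) (suc i) → refl }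

  step-rec = rec-* (rec-lookup (suc zero)) (rec-∘ H-rec forget-rec)

  primRec≡∏< : ∀ b xs → primRec (λ _ → 1) (λ ys → lookup ys (suc zero) * H (forget ys))
                                b xs ≡ ∏< b (λ y → H (y ∷ xs))
  primRec≡∏< zero    xs = refl
  primRec≡∏< (suc b) xs = cong (_* H (b ∷ xs)) (primRec≡∏< b xs)

-- Zero sets of recursive functions

-- The zero sets of total recursive functions are the recursive sets; this form
-- combines more easily than 0-1 characteristic functions.
IsZeroSet : Pred (Vec ℕ n) 0ℓ → Set
IsZeroSet P = ∃[ H ] IsRecursive H × (∀ xs → P xs ⇔ H xs ≡ 0)

recursive⇒zeroSet : {P : Pred (Vec ℕ n) 0ℓ} → IsRecursiveSet P → IsZeroSet P
recursive⇒zeroSet {P = P} (χ , χ-rec , χ-spec) =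
  (λ xs → isZero (χ xs)) , rec-isZero χ-rec , λ xs → mk⇔ (zero-on xs) (zero-off xs)
  where
  zero-on : ∀ xs → P xs → isZero (χ xs) ≡ 0
  zero-on xs p with χ-spec xs
  ... | inj₁ (_ , eq) = cong isZero eq
  ... | inj₂ (¬p , _) = contradiction p ¬p

  zero-off : ∀ xs → isZero (χ xs) ≡ 0 → P xs
  zero-off xs eq with χ-spec xs
  ... | inj₁ (p , _)   = p
  ... | inj₂ (_ , eq₀) with () ← trans (sym (cong isZero eq₀)) eq

zeroSet-∩ : {P Q : Pred (Vec ℕ n) 0ℓ} →
            IsZeroSet P → IsZeroSet Q → IsZeroSet (λ xs → P xs × Q xs)
zeroSet-∩ (F , F-rec , F-spec) (G , G-rec , G-spec) =
  (λ xs → F xs + G xs) , rec-+ F-rec G-rec , λ xs → mk⇔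
    (λ (p , q) → cong₂ _+_ (to (F-spec xs) p) (to (G-spec xs) q))
    (λ eq → from (F-spec xs) (m+n≡0⇒m≡0 (F xs) eq) ,
            from (G-spec xs) (m+n≡0⇒n≡0 (F xs) eq))

zeroSet-preimage : {P : Pred (Vec ℕ m) 0ℓ} {F : Vec ℕ n → Vec ℕ m} →
                   IsZeroSet P → IsRecursiveMap F → IsZeroSet (P ∘ F)
zeroSet-preimage {F = F} (H , H-rec , H-spec) F-rec =
  H ∘ F , rec-∘ H-rec F-rec , H-spec ∘ F

zeroSet-resp : {P Q : Pred (Vec ℕ n) 0ℓ} →
               (∀ xs → P xs ⇔ Q xs) → IsZeroSet P → IsZeroSet Q
zeroSet-resp P⇔Q (H , H-rec , H-spec) = H , H-rec , λ xs →
  mk⇔ (to (H-spec xs) ∘ from (P⇔Q xs)) (to (P⇔Q xs) ∘ from (H-spec xs))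

zeroSet-universal : {P : Pred (Vec ℕ n) 0ℓ} → (∀ xs → P xs) → IsZeroSet P
zeroSet-universal p = (λ _ → 0) , rec-const 0 , λ xs → mk⇔ (λ _ → refl) (λ _ → p xs)

-- Projections of zero sets

-- Sets {x | ∃ b. H(b, x) = 0} with H total recursive.
IsSemirecursive : Pred (Vec ℕ n) 0ℓ → Set
IsSemirecursive P = ∃[ H ] IsRecursive H × (∀ xs → P xs ⇔ (∃[ b ] H (b ∷ xs) ≡ 0))

zeroSet⇒semirecursive : {P : Pred (Vec ℕ n) 0ℓ} → IsZeroSet P → IsSemirecursive P
zeroSet⇒semirecursive (H , H-rec , H-spec) = H ∘ tail , rec-∘ H-rec tail-rec , λ xs →
  mk⇔ (λ p → 0 , to (H-spec xs) p) (λ (_ , eq) → from (H-spec xs) eq)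
  where
  tail-rec : IsRecursiveMap tail
  tail-rec = recMap-select suc λ { (_ ∷ _) i → refl }

-- A single new search variable b bounds both the old one, c, and the quantified y.
semirecursive-∃ : {P : Pred (Vec ℕ (suc n)) 0ℓ} →
                  IsSemirecursive P → IsSemirecursive (λ xs → ∃[ y ] P (y ∷ xs))
semirecursive-∃ {n} {P} (H , H-rec , H-spec) = K , K-rec , λ xs → mk⇔
  (λ (y , p) → let c , eq = to (H-spec (y ∷ xs)) p in
    suc (y ⊔ c) , ⇒∏<≡0 (s≤s (m≤m⊔n y c)) (⇒∏<≡0 (s≤s (m≤n⊔m y c)) eq))
  (λ (b , eq) → let y , eq′ = ∏<≡0⇒ b eq ; c , eq″ = ∏<≡0⇒ b eq′ in
    y , from (H-spec (y ∷ xs)) (c , eq″))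
  where
  K : Vec ℕ (suc n) → ℕ
  K zs = ∏< (lookup zs zero) λ y → ∏< (lookup zs zero) λ c → H (c ∷ y ∷ tail zs)

  -- Drops b from the arguments (c, y, b, x).
  forget : Vec ℕ (suc (suc (suc n))) → Vec ℕ (suc (suc n))
  forget ws = head ws ∷ head (tail ws) ∷ tail (tail (tail ws))

  forget-rec : IsRecursiveMap forget
  forget-rec = recMap-select
    (λ { zero → zero ; (suc zero) → suc zero ; (suc (suc i)) → suc (suc (suc i)) })
    λ { (_ ∷ _ ∷ _ ∷ _) zero          → refl
      ; (_ ∷ _ ∷ _ ∷ _) (suc zero)    → refl
      ; (_ ∷ _ ∷ _ ∷ _) (suc (suc i)) → refl }

  K-rec : IsRecursive K
  K-rec = rec-∏< (rec-lookup zero)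
            (rec-∏< (rec-lookup (suc zero)) (rec-∘ H-rec forget-rec))

semirecursive-∃ⁿ : ∀ l {P : Pred (Vec ℕ (l + n)) 0ℓ} → IsSemirecursive P →
                   IsSemirecursive (λ xs → ∃ λ (ys : Vec ℕ l) → P (ys ++ xs))
semirecursive-∃ⁿ zero (H , H-rec , H-spec) = H , H-rec , λ xs →
  mk⇔ (λ { ([] , p) → to (H-spec xs) p }) (λ h → [] , from (H-spec xs) h)
semirecursive-∃ⁿ (suc l) {P} P-semi
  with H , H-rec , H-spec ← semirecursive-∃ⁿ l (semirecursive-∃ {P = P} P-semi) =
  H , H-rec , λ xs → mk⇔
    (λ { (y ∷ ys , p) → to (H-spec xs) (ys , y , p) })
    (λ h → let ys , y , p = from (H-spec xs) h in y ∷ ys , p)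

-- The parameters come first in a Diophantine definition, but recursion and
-- minimisation act on leading coordinates, so the two blocks are exchanged.
swap-rec : ∀ k l → IsRecursiveMap {l + k} {k + l} (λ zs → drop l zs ++ take l zs)
swap-rec k l = recMap-select σ σ-correct
  where
  σ : Fin (k + l) → Fin (l + k)
  σ i = [ l ↑ʳ_ , _↑ˡ k ]′ (splitAt k i)

  σ-correct : ∀ zs i → lookup zs (σ i) ≡ lookup (drop l zs ++ take l zs) i
  σ-correct zs i with ys , xs , refl ← Vec.splitAt l zs
    rewrite lookup-splitAt k xs ys i with splitAt k i
  ... | inj₁ p = lookup-++ʳ ys xs p
  ... | inj₂ p = lookup-++ˡ ys xs p

take-++ : (xs : Vec ℕ m) (ys : Vec ℕ n) → take m (xs ++ ys) ≡ xs
take-++ []       ys = refl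
take-++ (x ∷ xs) ys = cong (x ∷_) (take-++ xs ys)

drop-++ : (xs : Vec ℕ m) (ys : Vec ℕ n) → drop m (xs ++ ys) ≡ ys
drop-++ []       ys = refl
drop-++ (x ∷ xs) ys = drop-++ xs ys

projection-semirecursive : ∀ {k} l {P : Pred (Vec ℕ (k + l)) 0ℓ} → IsZeroSet P →
                           IsSemirecursive (λ xs → ∃ λ (ys : Vec ℕ l) → P (xs ++ ys))
projection-semirecursive {k} l {P} P-zero
  with H , H-rec , H-spec ← semirecursive-∃ⁿ l
         (zeroSet⇒semirecursive (zeroSet-preimage {P = P} P-zero (swap-rec k l))) =
  H , H-rec , λ xs → mk⇔
    (λ (ys , p) → to (H-spec xs) (ys , subst P (sym (swapped xs ys)) p))
    (λ h → let ys , p = from (H-spec xs) h in ys , subst P (swapped xs ys) p)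
  where
  swapped : (xs : Vec ℕ k) (ys : Vec ℕ l) →
            drop l (ys ++ xs) ++ take l (ys ++ xs) ≡ xs ++ ys
  swapped xs ys = cong₂ _++_ (drop-++ ys xs) (take-++ ys xs)

-- Unbounded search

-- By induction on the code rather than on the derivation: when two results of μ
-- differ, the value at the smaller one comes from the function stored in the other
-- derivation, which is not a structural subterm.
⇓-functional : (e : Code n) → ∀ {xs y z} → e ∙ xs ⇓ y → e ∙ xs ⇓ z → y ≡ z
⇓-functional* : (es : Vec (Code n) m) → ∀ {xs ys zs} →
                Pointwise (λ e y → e ∙ xs ⇓ y) es ys →
                Pointwise (λ e y → e ∙ xs ⇓ y) es zs → ys ≡ zs

⇓-functional zero ⇓zero ⇓zero = refl
⇓-functional suc  ⇓suc  ⇓suc  = refl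
⇓-functional (proj i) (⇓proj .i) (⇓proj .i) = refl
⇓-functional (comp g hs) (⇓comp ds d) (⇓comp ds′ d′)
  with refl ← ⇓-functional* hs ds ds′ = ⇓-functional g d d′
⇓-functional (prec g h) (⇓prec₀ d) (⇓prec₀ d′) = ⇓-functional g d d′
⇓-functional (prec g h) (⇓precₛ c d) (⇓precₛ c′ d′)
  with refl ← ⇓-functional (prec g h) c c′ = ⇓-functional h d d′
⇓-functional (μ f) {y = y} {z} (⇓μ below d) (⇓μ below′ d′) with <-cmp y z
... | tri≈ _ y≡z _ = y≡z
... | tri< y<z _ _ with _ , d₊ ← below′ y y<z with () ← ⇓-functional f d d₊
... | tri> _ _ z<y with _ , d₊ ← below z z<y with () ← ⇓-functional f d′ d₊

⇓-functional* []       []       []         = refl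
⇓-functional* (e ∷ es) (d ∷ ds) (d′ ∷ ds′) =
  cong₂ _∷_ (⇓-functional e d d′) (⇓-functional* es ds ds′)

leastZero : (h : ℕ → ℕ) → ∀ b → h b ≡ 0 →
            ∃[ m ] (∀ i → i < m → ∃[ y ] h i ≡ suc y) × h m ≡ 0
leastZero h zero    eq = 0 , (λ _ ()) , eq
leastZero h (suc b) eq with h 0 in h0
... | zero  = 0 , (λ _ ()) , h0
... | suc y with m , below , hm ← leastZero (h ∘ suc) b eq = suc m , below′ , hm
  where
  below′ : ∀ i → i < suc m → ∃[ y ] h i ≡ suc y
  below′ zero    _         = y , h0
  below′ (suc i) (s≤s i<m) = below i i<m

semirecursive⇒re : {P : Pred (Vec ℕ n) 0ℓ} → IsSemirecursive P → IsRESet P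
semirecursive⇒re (H , (e , e⇓) , H-spec) = μ e , λ xs → mk⇔
  (λ p → let b , eq = to (H-spec xs) p
             m , below , Hm = leastZero (λ i → H (i ∷ xs)) b eq in
    m , ⇓μ (λ i i<m → let y , Hi = below i i<m in
                      y , subst (e ∙ i ∷ xs ⇓_) Hi (e⇓ (i ∷ xs)))
           (subst (e ∙ m ∷ xs ⇓_) Hm (e⇓ (m ∷ xs))))
  (λ { (m , ⇓μ _ d) → from (H-spec xs) (m , ⇓-functional e (e⇓ (m ∷ xs)) d) })

-- Codes of ring elements

module _ (R : RecursiveRing) where
  open RecursiveRing R

  -- The tuples consisting of codes of ring elements.
  AreCodes : Pred (Vec ℕ n) 0ℓ
  AreCodes ns = ∃[ xs ] map j xs ≡ ns

  codes-zeroSet : ∀ n → IsZeroSet (AreCodes {n})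
  codes-zeroSet zero    = zeroSet-universal λ { [] → [] , refl }
  codes-zeroSet (suc n) = zeroSet-resp splitCodes (zeroSet-∩
    (zeroSet-preimage (recursive⇒zeroSet image-recursive)
      (recMap-∷ (rec-lookup zero) recMap-[]))
    (zeroSet-preimage (codes-zeroSet n) (recMap-select suc λ { (_ ∷ _) i → refl })))
    where
    splitCodes : ∀ ns → ((∃[ x ] [ j x ] ≡ [ lookup ns zero ]) × AreCodes (tail ns)) ⇔
                        AreCodes ns
    splitCodes (_ ∷ _) = mk⇔
      (λ { ((x , eq) , xs , eqs) → x ∷ xs , cong₂ _∷_ (∷-injectiveˡ eq) eqs })
      (λ { (x ∷ xs , eq) →
           (x , cong [_] (∷-injectiveˡ eq)) , xs , ∷-injectiveʳ eq })

  map-j-injective : {xs ys : Vec Carrier n} → map j xs ≡ map j ys → xs ≋ ys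
  map-j-injective {xs = []}     {[]}     _  = []
  map-j-injective {xs = x ∷ xs} {y ∷ ys} eq =
    Injection.injective rep (∷-injectiveˡ eq) ∷ map-j-injective (∷-injectiveʳ eq)

  codeImage-map-j : ∀ {k} (S : Subset R k) (xs : Vec Carrier k) →
                    codeImage j (holds S) (map j xs) ⇔ holds S xs
  codeImage-map-j S xs = mk⇔
    (λ (ys , ys∈S , eq) → resp S (map-j-injective eq) ys∈S)
    (λ xs∈S → xs , xs∈S , refl)

-- Diophantine sets are recursively enumerable

module _ {L : Language} {R : RecursiveRing} (I : Interpretation L R)
         (I-rec : Interpretation.IsRecursiveInterpretation I) where
  open Syntax L
  open RecursiveRing R
  open Interpretation I

  private
    fun-rec = proj₁ I-rec
    rel-rec = proj₂ I-rec

  eval-rec  : ∀ {v} (t : Term v) → IsRecursiveOp j (λ ρ → eval I ρ t)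
  evals-rec : ∀ {v} (ts : Vec (Term v) n) →
              ∃[ F ] IsRecursiveMap F × (∀ ρ → F (map j ρ) ≡ map j (evals I ρ ts))
  eval-rec (var i)   = (λ ns → lookup ns i) , rec-lookup i , λ ρ → lookup-map i j ρ
  eval-rec (const c) = (λ _ → j ⟦ c ⟧ᶜ) , rec-const _ , λ _ → refl
  eval-rec (app F ts)
    with G , G-rec , G-spec ← fun-rec F
       | T , T-rec , T-spec ← evals-rec ts =
    G ∘ T , rec-∘ G-rec T-rec , λ ρ → trans (cong G (T-spec ρ)) (G-spec (evals I ρ ts))
  evals-rec []       = (λ _ → []) , recMap-[] , λ _ → refl
  evals-rec (t ∷ ts)
    with F , F-rec , F-spec ← eval-rec t
       | T , T-rec , T-spec ← evals-rec ts =
    (λ ns → F ns ∷ T ns) , recMap-∷ F-rec T-rec , λ ρ → cong₂ _∷_ (F-spec ρ) (T-spec ρ)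

  -- A condition on tuples of ring elements agreeing, on codes, with a zero set;
  -- the zero set is unconstrained off the codes.
  IsZeroSetOnCodes : ∀ {v} → Pred (Vec Carrier v) 0ℓ → Set₁
  IsZeroSetOnCodes {v} Q =
    ∃[ Z ] IsZeroSet {v} Z × (∀ ρ → Z (map j ρ) ⇔ Q ρ)

  sat-zeroSet : ∀ {v} (φ : BasicFormula v) → IsZeroSetOnCodes (λ ρ → Sat I ρ φ)
  sat-zeroSet (rel P ts) with T , T-rec , T-spec ← evals-rec ts =
    codeImage j (holds ⟦ P ⟧ʳ) ∘ T ,
    zeroSet-preimage (recursive⇒zeroSet (rel-rec P)) T-rec ,
    λ ρ → subst (λ ns → codeImage j (holds ⟦ P ⟧ʳ) ns ⇔ _) (sym (T-spec ρ))
            (codeImage-map-j R ⟦ P ⟧ʳ (evals I ρ ts))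

  sats-zeroSet : ∀ {v} (φs : List (BasicFormula v)) →
                 IsZeroSetOnCodes (λ ρ → All (Sat I ρ) φs)
  sats-zeroSet []       = (λ _ → ⊤) , zeroSet-universal (λ _ → tt) ,
                          λ ρ → mk⇔ (λ _ → []) (λ _ → tt)
  sats-zeroSet (φ ∷ φs)
    with Y , Y-zero , Y-spec ← sat-zeroSet φ
       | Z , Z-zero , Z-spec ← sats-zeroSet φs =
    (λ ns → Y ns × Z ns) , zeroSet-∩ Y-zero Z-zero , λ ρ → mk⇔
      (λ (y , z) → to (Y-spec ρ) y ∷ to (Z-spec ρ) z)
      (λ { (s ∷ ss) → from (Y-spec ρ) s , from (Z-spec ρ) ss })

  diophantine⇒re : ∀ {k} (S : Subset R k) → IsDiophantine I S → IsRE S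
  diophantine⇒re {k} S (l , φs , S-spec)
    with Z , Z-zero , Z-spec ← sats-zeroSet φs
    with e , e-spec ← semirecursive⇒re (projection-semirecursive {k} l
           (zeroSet-∩ (codes-zeroSet R (k + l)) Z-zero)) =
    e , λ ns → mk⇔ (to (e-spec ns) ∘ solve ns) (project ns ∘ from (e-spec ns))
    where
    solve : ∀ ns → codeImage j (holds S) ns →
            ∃ λ (ms : Vec ℕ l) → AreCodes R (ns ++ ms) × Z (ns ++ ms)
    solve _ (xs , xs∈S , refl) with ys , sats ← to (S-spec xs) xs∈S =
      map j ys , (xs ++ ys , map-++ j xs ys) ,
      subst Z (map-++ j xs ys) (from (Z-spec (xs ++ ys)) sats)

    project : ∀ ns → (∃ λ (ms : Vec ℕ l) → AreCodes R (ns ++ ms) × Z (ns ++ ms)) →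
              codeImage j (holds S) ns
    project ns (ms , (ρ , eq) , z) with xs , ys , refl ← Vec.splitAt k ρ =
      xs , from (S-spec xs) (ys , to (Z-spec (xs ++ ys)) (subst Z (sym eq) z)) ,
      ++-injectiveˡ (map j xs) ns (trans (sym (map-++ j xs ys)) eq)

lemma6p22 : (R₁ R₂ : RecursiveRing) (L₁ L₂ : Language)
    (I₁ : Interpretation L₁ R₁) (I₂ : Interpretation L₂ R₂) →
    Interpretation.IsRecursiveInterpretation I₁ →
    Interpretation.IsRecursiveInterpretation I₂ →
    MRDP I₂ →
    (f : Func (RecursiveRing.≈-setoid R₁) (RecursiveRing.≈-setoid R₂)) →
    IsREPreserving {R₁} {R₂} f → IsDiophantineMap I₁ I₂ f
lemma6p22 R₁ R₂ L₁ L₂ I₁ I₂ I₁-rec I₂-rec mrdp f f-re k S S-dioph =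
  mrdp k (image f S) (f-re k S (diophantine⇒re I₁ I₁-rec S S-dioph))
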